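{- Let $\kappa$ be an infinite cardinal and $\lambda$ a cardinal. A function $F:{}^{\lambda}\kappa\to\kappa$ is a weakly uniform proper coloring if and only if there are a $\kappa^{+}$-complete ultrafilter $\mathscr{U}$ on $\lambda$ and a permutation $\pi\in \mathrm{Sym}(\kappa)$ such that for all $x\in{}^{\lambda}\kappa$ and $\alpha\in\kappa$, $$F(x)=\pi(\alpha)\iff \{i\in\lambda : x(i)=\alpha\}\in\mathscr{U}.$$
   Context: ${}^{\lambda}\kappa$ is the set of all functions from $\lambda$ to $\kappa$. Two functions $x,y\in{}^{\lambda}\kappa$ are totally different, written $x\perp y$, if $x(i)\neq y(i)$ for all $i\in\lambda$. A function $F:{}^{\lambda}\kappa\to\kappa$ is a proper coloring if $F(x)\ne F(y)$ whenever $x,y\in{}^{\lambda}\kappa$ and $x\perp y$. A proper coloring $F:{}^{\lambda}\kappa\to\kappa$ is weakly uniform if there is a sequence $(r_\alpha)_{\alpha<\kappa}$ in ${}^{\lambda}\kappa$ such that $F(r_\alpha)=\alpha$ for all $\alpha\in\kappa$ and $r_\alpha\perp r_\beta$ for all $\alpha\ne\beta$ in $\kappa$. $\mathrm{Sym}(A)$ is the set of all bijections $A\to A$. An ultrafilter is $\kappa^{+}$-complete if it is closed under intersections of at most $\kappa$ many of its members. -}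

module Defs where

open import Level using (Level; suc)
open import Data.Fin.Base using (Fin)
open import Data.Product.Base using (_×_; Σ-syntax)
open import Data.Sum.Base using (_⊎_)
open import Function.Bundles using (_↔_; _↣_; _⤖_)
open import Relation.Binary.PropositionalEquality.Core using (_≡_; _≢_)
open import Relation.Nullary.Negation.Core using (¬_)
open import Relation.Unary using (Pred; ∁; _∩_; _⊆_; ⋂)
open import Relation.Unary.Polymorphic using (∅; U)

-- A cardinal is represented by an arbitrary type of that cardinality (its
-- well-ordering plays no role), so κ and Λ below are types and Λ → κ is the
-- set of functions written ^λκ.

Infinite : ∀ {ℓ} → Set ℓ → Set ℓ
Infinite A = ∀ n → ¬ (A ↔ Fin n)

Sym : ∀ {ℓ} → Set ℓ → Set ℓ
Sym A = A ⤖ A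

module _ {ℓ : Level} {Λ κ : Set ℓ} where

  infix 4 _⊥_

  _⊥_ : (Λ → κ) → (Λ → κ) → Set ℓ
  x ⊥ y = ∀ i → x i ≢ y i

  IsProperColoring : ((Λ → κ) → κ) → Set ℓ
  IsProperColoring F = ∀ x y → x ⊥ y → F x ≢ F y

  IsWeaklyUniform : ((Λ → κ) → κ) → Set ℓ
  IsWeaklyUniform F =
    Σ[ r ∈ (κ → Λ → κ) ] (∀ (α : κ) → F (r α) ≡ α) × (∀ α β → α ≢ β → r α ⊥ r β)

record IsUltrafilter {ℓ} {A : Set ℓ} (𝒰 : Pred (Pred A ℓ) ℓ) : Set (suc ℓ) where
  field
    universe  : 𝒰 U
    empty     : ¬ 𝒰 ∅
    upward    : ∀ P Q → P ⊆ Q → 𝒰 P → 𝒰 Q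
    intersect : ∀ P Q → 𝒰 P → 𝒰 Q → 𝒰 (P ∩ Q)
    ultra     : ∀ P → 𝒰 P ⊎ 𝒰 (∁ P)

-- κ⁺-completeness.  A set of at most κ many members of 𝒰 is given as a family
-- indexed by a type J that injects into κ.
IsSuccComplete : ∀ {ℓ} (κ : Set ℓ) {A : Set ℓ} → Pred (Pred A ℓ) ℓ → Set (suc ℓ)
IsSuccComplete {ℓ} κ {A} 𝒰 =
  ∀ (J : Set ℓ) → J ↣ κ → (P : J → Pred A ℓ) → (∀ j → 𝒰 (P j)) → 𝒰 (⋂ J P)

{-# OPTIONS --safe #-}
module Submission where

-- Composing F with (r_α) gives a colouring G(y) = F(i ↦ r_{y(i)}(i)) with
-- G(const α) = α, which takes on each function one of its values.  A function with
-- two values c on P and d off P thus gets colour c or d, and totally different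
-- functions show that the choice depends on P alone, not on c and d; the P for which
-- c wins form the ultrafilter.  If {x = r_{F x}} were not large, replacing r_{F x}
-- by another r_γ on that set would give a function of colour F x totally different
-- from x.  Hence F x is determined by x modulo 𝒰, and κ⁺-completeness, which makes
-- every r_β constant on a large set, turns α ↦ F(const α) into a permutation.

open import Defs
open import Axiom.ExcludedMiddle using (ExcludedMiddle)
open import Axiom.DoubleNegationElimination using (DoubleNegationElimination; em⇒dne)
open import Data.Bool.Base using (if_then_else_)
open import Data.Fin.Base using (zero; suc)
open import Data.List.Base using (List; []; _∷_; length; lookup; deduplicate)
open import Data.List.Membership.Propositional using (_∈_; _∉_)
open import Data.List.Membership.Propositional.Properties using (∈-lookup; ∈-deduplicate⁺)
open import Data.List.Relation.Unary.Any using (here; there; index)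
open import Data.List.Relation.Unary.Any.Properties using (lookup-index)
open import Data.List.Relation.Unary.All as All using ()
open import Data.List.Relation.Unary.AllPairs using (_∷_)
open import Data.List.Relation.Unary.Unique.Propositional using (Unique)
open import Data.List.Relation.Unary.Unique.DecPropositional.Properties using (deduplicate-!)
open import Data.Product.Base using (_×_; Σ-syntax; ∃; ∃₂; _,_; proj₁; proj₂)
open import Data.Sum.Base using (_⊎_; inj₁; inj₂; [_,_])
open import Function.Base using (const; id; _∘_)
open import Function.Bundles
  using (_⇔_; mk⇔; mk↔ₛ′; _↣_; mk⤖; module Bijection; module Equivalence; module Injection)
open import Function.Construct.Identity using (↣-id)
open import Function.Consequences.Propositional using (strictlySurjective⇒surjective)
open import Level using (lower)
open import Relation.Binary.PropositionalEquality
  using (_≡_; _≢_; refl; sym; trans; cong; ≢-sym)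
open import Relation.Nullary.Decidable.Core using (yes; no; does)
open import Relation.Nullary.Negation.Core using (¬_; contradiction)
open import Relation.Unary using (Pred; ∁; _∩_; ⋂)

-- Fresh elements of an infinite type.

lookup-injective : ∀ {ℓ} {A : Set ℓ} {xs : List A} → Unique xs →
                   ∀ i j → lookup xs i ≡ lookup xs j → i ≡ j
lookup-injective (_  ∷ _) zero    zero    _  = refl
lookup-injective (x∉ ∷ _)  zero    (suc j) eq = contradiction eq (All.lookup x∉ (∈-lookup j))
lookup-injective (x∉ ∷ _)  (suc i) zero    eq = contradiction (sym eq) (All.lookup x∉ (∈-lookup i))
lookup-injective (_  ∷ u) (suc i) (suc j) eq = cong suc (lookup-injective u i j eq)

module _ {ℓ} (em : ExcludedMiddle ℓ) where

  private
    dne : DoubleNegationElimination ℓ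
    dne = em⇒dne em

  abstract
    -- If `xs` exhausted `A`, its deduplication would enumerate `A` bijectively by some `Fin n`.
    fresh : {A : Set ℓ} → Infinite A → (xs : List A) → Σ[ a ∈ A ] a ∉ xs
    fresh {A} infinite xs = dne λ none →
      let
        ys = deduplicate (λ x y → em {x ≡ y}) xs

        all-in : ∀ a → a ∈ ys
        all-in a = ∈-deduplicate⁺ (λ x y → em {x ≡ y}) (dne λ a∉xs → none (a , a∉xs))

        lookup∘index : ∀ a → lookup ys (index (all-in a)) ≡ a
        lookup∘index a = sym (lookup-index (all-in a))
      in infinite (length ys) (mk↔ₛ′
           (index ∘ all-in)
           (lookup ys)
           (λ i → lookup-injective (deduplicate-! (λ x y → em {x ≡ y}) xs) _ _
                    (lookup∘index (lookup ys i)))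
           lookup∘index)

    distinct-pair : {A : Set ℓ} → Infinite A → ∃₂ λ (a b : A) → a ≢ b
    distinct-pair infinite =
      let a , _   = fresh infinite []
          b , b∉a = fresh infinite (a ∷ [])
      in a , b , λ a≡b → b∉a (here (sym a≡b))

  -- Functions glued along a subset.

  module _ {Λ A : Set ℓ} where

    abstract
      piecewise : Pred Λ ℓ → (Λ → A) → (Λ → A) → Λ → A
      piecewise P x y i = if does (em {P i}) then x i else y i

      piecewise-elim : ∀ {q} (Q : A → Set q) P {x y} i →
                       (P i → Q (x i)) → (¬ P i → Q (y i)) → Q (piecewise P x y i)
      piecewise-elim Q P i on off with em {P i}
      ... | yes p = on p
      ... | no ¬p = off ¬p

    piecewise-on : ∀ P {x y : Λ → A} {i} → P i → piecewise P x y i ≡ x i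
    piecewise-on P {x} {i = i} p =
      piecewise-elim (_≡ x i) P i (λ _ → refl) (contradiction p)

    piecewise-off : ∀ P {x y : Λ → A} {i} → ¬ P i → piecewise P x y i ≡ y i
    piecewise-off P {y = y} {i = i} ¬p =
      piecewise-elim (_≡ y i) P i (λ p → contradiction p ¬p) (λ _ → refl)

  -- The ultrafilter of a normalized colouring.

  module NormalizedColoring
    {κ Λ : Set ℓ} (infinite : Infinite κ)
    (G : (Λ → κ) → κ) (proper : IsProperColoring G)
    (G-const : ∀ α → G (const α) ≡ α)
    where

    -- P is large when the value of a function on P, if constant, decides its
    -- colour.  Quantifying over all functions that equal β on P keeps 𝒰
    -- extensional in P without function extensionality.
    𝒰 : Pred (Pred Λ ℓ) ℓ
    𝒰 P = ∀ y β → (∀ i → P i → y i ≡ β) → G y ≡ β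

    private
      a b : κ
      a = proj₁ (distinct-pair infinite)
      b = proj₁ (proj₂ (distinct-pair infinite))

      a≢b : a ≢ b
      a≢b = proj₂ (proj₂ (distinct-pair infinite))

    -- It uses only `a` and `b`, so that it can serve as the part off `P` in `wins-three-valued`.
    avoid : (Λ → κ) → Λ → κ
    avoid y = piecewise (λ i → y i ≡ a) (const b) (const a)

    avoid-⊥ : ∀ y → avoid y ⊥ y
    avoid-⊥ y i = piecewise-elim (_≢ y i) (λ j → y j ≡ a) i
      (λ y≡a b≡y → a≢b (sym (trans b≡y y≡a)))
      (λ y≢a a≡y → y≢a (sym a≡y))

    -- Otherwise `y` and `const (G y)` would be totally different with equal colours.
    attains : ∀ y → Σ[ i ∈ Λ ] y i ≡ G y
    attains y = dne λ none →
      proper y (const (G y)) (λ i e → none (i , e)) (sym (G-const (G y)))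

    -- Otherwise overwriting `avoid y` by `G y` on `P` gives a function totally different from `y`,
    -- yet of colour `G y` because `P` is large.
    large-attains : ∀ {P} → 𝒰 P → ∀ y → Σ[ i ∈ Λ ] P i × y i ≡ G y
    large-attains {P} P∈𝒰 y = dne λ none →
      let z = piecewise P (const (G y)) (avoid y)
      in proper z y
           (λ i → piecewise-elim (_≢ y i) P i
             (λ p g≡y → none (i , p , sym g≡y))
             (λ _ → avoid-⊥ y i))
           (P∈𝒰 z (G y) (λ _ → piecewise-on P))

    Takes : Pred Λ ℓ → κ → κ → Pred (Λ → κ) ℓ
    Takes P c d z = (∀ i → P i → z i ≡ c) × (∀ i → ¬ P i → z i ≡ d)

    Wins : Pred Λ ℓ → κ → κ → Set ℓ
    Wins P c d = ∀ z → Takes P c d z → G z ≡ c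

    takes-value : ∀ P {c d z} → Takes P c d z → G z ≡ c ⊎ G z ≡ d
    takes-value P {z = z} (on , off) with attains z
    ... | i , zi≡Gz with em {P i}
    ...   | yes p = inj₁ (trans (sym zi≡Gz) (on i p))
    ...   | no ¬p = inj₂ (trans (sym zi≡Gz) (off i ¬p))

    piecewise-takes : ∀ P c d → Takes P c d (piecewise P (const c) (const d))
    piecewise-takes P c d = (λ _ → piecewise-on P) , (λ _ → piecewise-off P)

    -- The function with `e` on `P` and `c` off `P` is totally different from `y`, so its colour is
    -- not `c`; its only other value is `e`.
    wins-rotate : ∀ {P c d e y} → c ≢ d → e ≢ c → Takes P c d y → G y ≡ c → Wins P e c
    wins-rotate {P} {y = y} c≢d e≢c (y-on , y-off) Gy≡c z z-takes@(z-on , z-off)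
      with takes-value P z-takes
    ... | inj₁ Gz≡e = Gz≡e
    ... | inj₂ Gz≡c = contradiction (trans Gz≡c (sym Gy≡c)) (proper z y z⊥y)
      where
      z⊥y : z ⊥ y
      z⊥y i zi≡yi with em {P i}
      ... | yes p = e≢c (trans (sym (z-on i p)) (trans zi≡yi (y-on i p)))
      ... | no ¬p = c≢d (trans (sym (z-off i ¬p)) (trans zi≡yi (y-off i ¬p)))

    -- Rotations lead from `(c , d)` through `(g , c)` and `(f , g)` to `(e , f)`; a fresh `g` keeps
    -- the entries of each pair distinct.
    wins-everywhere : ∀ {P c d y} → c ≢ d → Takes P c d y → G y ≡ c →
                      ∀ e f → e ≢ f → Wins P e f
    wins-everywhere {P} {c} {d} c≢d y-takes Gy≡c e f e≢f =
      rotate (≢-sym g≢f) e≢f (rotate g≢c (≢-sym g≢f)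
        (wins-rotate c≢d g≢c y-takes Gy≡c))
      where
      g : κ
      g = proj₁ (fresh infinite (c ∷ f ∷ []))

      g≢c : g ≢ c
      g≢c g≡c = proj₂ (fresh infinite (c ∷ f ∷ [])) (here g≡c)

      g≢f : g ≢ f
      g≢f g≡f = proj₂ (fresh infinite (c ∷ f ∷ [])) (there (here g≡f))

      rotate : ∀ {s t u} → s ≢ t → u ≢ s → Wins P s t → Wins P u s
      rotate {s} {t} s≢t u≢s wins =
        let takes = piecewise-takes P s t
        in wins-rotate s≢t u≢s takes (wins _ takes)

    -- Were `G y` not `c`, the function with `G y` on `P` and a fresh `f` off `P` would have the
    -- colour of `y` and be totally different from it.
    wins-three-valued :
      ∀ {P} → (∀ e f → e ≢ f → Wins P e f) →
      ∀ y {c d e} → (∀ i → P i → y i ≡ c) → (∀ i → ¬ P i → y i ≡ d ⊎ y i ≡ e) →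
      G y ≡ c
    wins-three-valued {P} wins y {c} {d} {e} on off = dne λ Gy≢c →
      let
        f , f∉ = fresh infinite (d ∷ e ∷ G y ∷ [])
        takes  = piecewise-takes P (G y) f
      in proper (piecewise P (const (G y)) (const f)) y
           (λ i → piecewise-elim (_≢ y i) P i
             (λ p Gy≡yi → Gy≢c (trans Gy≡yi (on i p)))
             (λ ¬p f≡yi → [ (λ yi≡d → f∉ (here (trans f≡yi yi≡d)))
                          , (λ yi≡e → f∉ (there (here (trans f≡yi yi≡e)))) ] (off i ¬p)))
           (wins (G y) f (λ Gy≡f → f∉ (there (there (here (sym Gy≡f))))) _ takes)

    -- Off `P` the function `y` is arbitrary, so it is compared with a three-valued `z` that has
    -- `G y` on `P`.
    wins⇒large : ∀ {P} → (∀ e f → e ≢ f → Wins P e f) → 𝒰 P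
    wins⇒large {P} wins y β on = dne λ Gy≢β →
      let z = piecewise P (const (G y)) (avoid y)
      in proper z y
           (λ i → piecewise-elim (_≢ y i) P i
             (λ p Gy≡yi → Gy≢β (trans Gy≡yi (on i p)))
             (λ _ → avoid-⊥ y i))
           (wins-three-valued wins z (λ _ → piecewise-on P)
             (λ i ¬p → piecewise-elim (λ w → w ≡ b ⊎ w ≡ a) P i
               (λ p → contradiction p ¬p)
               (λ _ → piecewise-elim (λ w → w ≡ b ⊎ w ≡ a) (λ j → y j ≡ a) i
                 (λ _ → inj₁ refl) (λ _ → inj₂ refl))))

    large⊎co-large : ∀ P → 𝒰 P ⊎ 𝒰 (∁ P)
    large⊎co-large P with piecewise-takes P a b
    ... | takes@(on , off) with takes-value P takes
    ...   | inj₁ G≡a = inj₁ (wins⇒large (wins-everywhere a≢b takes G≡a))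
    -- The same function takes `b` on `∁ P` and `a` off it.
    ...   | inj₂ G≡b = inj₂ (wins⇒large (wins-everywhere (≢-sym a≢b)
                         (off , λ i ¬¬p → on i (dne ¬¬p)) G≡b))

    large-nonempty : ∀ {P} → 𝒰 P → ∃ P
    large-nonempty P∈𝒰 = let i , p , _ = large-attains P∈𝒰 (const a) in i , p

    large-upward : ∀ P Q → (∀ {i} → P i → Q i) → 𝒰 P → 𝒰 Q
    large-upward P Q P⊆Q P∈𝒰 y β on = P∈𝒰 y β (λ i p → on i (P⊆Q p))

    -- If the complement of P ∩ Q were large, the function with values a off P,
    -- b on P ∖ Q and c on P ∩ Q would take its own colour nowhere on some large set.
    large-∩ : ∀ P Q → 𝒰 P → 𝒰 Q → 𝒰 (P ∩ Q)
    large-∩ P Q P∈𝒰 Q∈𝒰 with large⊎co-large (P ∩ Q)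
    ... | inj₁ PQ∈𝒰 = PQ∈𝒰
    ... | inj₂ R∈𝒰  = contradiction (attains y) λ (i , yi≡Gy) →
      piecewise-elim (_≢ G y) P i
        (λ _ → piecewise-elim (_≢ G y) Q i (λ _ → c≢Gy) (λ _ → b≢Gy))
        (λ _ → a≢Gy)
        yi≡Gy
      where
      c : κ
      c = proj₁ (fresh infinite (a ∷ b ∷ []))

      c≢a : c ≢ a
      c≢a c≡a = proj₂ (fresh infinite (a ∷ b ∷ [])) (here c≡a)

      c≢b : c ≢ b
      c≢b c≡b = proj₂ (fresh infinite (a ∷ b ∷ [])) (there (here c≡b))

      y : Λ → κ
      y = piecewise P (piecewise Q (const c) (const b)) (const a)

      a≢Gy : a ≢ G y
      a≢Gy a≡Gy with large-attains P∈𝒰 y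
      ... | i , p , yi≡Gy = piecewise-elim (_≢ a) P i
        (λ _ → piecewise-elim (_≢ a) Q i (λ _ → c≢a) (λ _ → ≢-sym a≢b))
        (contradiction p)
        (trans yi≡Gy (sym a≡Gy))

      b≢Gy : b ≢ G y
      b≢Gy b≡Gy with large-attains Q∈𝒰 y
      ... | i , q , yi≡Gy = piecewise-elim (_≢ b) P i
        (λ _ → piecewise-elim (_≢ b) Q i (λ _ → c≢b) (contradiction q))
        (λ _ → a≢b)
        (trans yi≡Gy (sym b≡Gy))

      c≢Gy : c ≢ G y
      c≢Gy c≡Gy with large-attains R∈𝒰 y
      ... | i , ¬pq , yi≡Gy = piecewise-elim (_≢ c) P i
        (λ p → piecewise-elim (_≢ c) Q i (λ q → contradiction (p , q) ¬pq) (λ _ → ≢-sym c≢b))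
        (λ _ → ≢-sym c≢a)
        (trans yi≡Gy (sym c≡Gy))

    isUltrafilter : IsUltrafilter 𝒰
    isUltrafilter = record
      { universe  = λ y β on → let i , yi≡Gy = attains y in trans (sym yi≡Gy) (on i _)
      ; empty     = λ ∅∈𝒰 → lower (proj₂ (large-nonempty ∅∈𝒰))
      ; upward    = large-upward
      ; intersect = large-∩
      ; ultra     = large⊎co-large
      }

    -- Where ⋂ P fails, let y name an index j with i ∉ P j; the colour of y then
    -- names some j, and y does not take this value on the large set P j ∖ ⋂ P.
    isSuccComplete : IsSuccComplete κ 𝒰
    isSuccComplete J J↣κ P P∈𝒰 with large⊎co-large (⋂ J P)
    ... | inj₁ ⋂∈𝒰 = ⋂∈𝒰
    ... | inj₂ R∈𝒰 = contradiction (large-attains R∈𝒰 y) λ (i , ¬all , yi≡Gy) →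
      let
        j , _ , yi≡fj = named i ¬all
        k , (Pjk , ¬all′) , yk≡Gy = large-attains (large-∩ _ _ (P∈𝒰 j) R∈𝒰) y
        j′ , ¬Pj′k , yk≡fj′ = named k ¬all′
        fj≡fj′ = trans (sym yi≡fj) (trans yi≡Gy (trans (sym yk≡Gy) yk≡fj′))
      in absurd Pjk ¬Pj′k (Injection.injective J↣κ fj≡fj′)
      where
      f : J → κ
      f = Injection.to J↣κ

      failing : ∀ i → Set ℓ
      failing i = Σ[ j ∈ J ] ¬ P j i

      y : Λ → κ
      y i with em {failing i}
      ... | yes (j , _) = f j
      -- A default on `⋂ J P`; the points examined above all lie outside it.
      ... | no _ = a

      named : ∀ i → ¬ ⋂ J P i → Σ[ j ∈ J ] (¬ P j i) × (y i ≡ f j)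
      named i ¬all with em {failing i}
      ... | yes (j , ¬Pji) = j , ¬Pji , refl
      ... | no none = contradiction (λ j → dne λ ¬Pji → none (j , ¬Pji)) ¬all

      absurd : ∀ {j j′ k} {A : Set} → P j k → ¬ P j′ k → j ≡ j′ → A
      absurd Pjk ¬Pjk refl = contradiction Pjk ¬Pjk

  -- From weakly uniform colourings to ultrafilters.

  module WeaklyUniformColoring
    {κ Λ : Set ℓ} (infinite : Infinite κ)
    (F : (Λ → κ) → κ) (proper : IsProperColoring F)
    (r : κ → Λ → κ) (F-r : ∀ α → F (r α) ≡ α) (r-⊥ : ∀ α β → α ≢ β → r α ⊥ r β)
    where

    r-injective : ∀ {i α β} → r α i ≡ r β i → α ≡ β
    r-injective {i} {α} {β} eq = dne λ α≢β → r-⊥ α β α≢β i eq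

    -- On `const α` this colouring is `F (r α)` by definition, so `F-r` normalizes it.
    open NormalizedColoring infinite
      (λ y → F (λ i → r (y i) i))
      (λ x y x⊥y → proper _ _ (λ i eq → x⊥y i (r-injective eq)))
      F-r
      public

    agrees-with-representative : ∀ x → 𝒰 (λ i → x i ≡ r (F x) i)
    agrees-with-representative x with large⊎co-large (λ i → x i ≡ r (F x) i)
    ... | inj₁ large    = large
    ... | inj₂ co-large = contradiction (co-large y (F x) (λ _ → piecewise-off E))
                            (proper _ x λ i → piecewise-elim (λ w → r w i ≢ x i) E i
                              (λ xi≡ri rγ≡xi → γ∉ (here (r-injective (trans rγ≡xi xi≡ri))))
                              (λ xi≢ri ri≡xi → xi≢ri (sym ri≡xi)))
      where
      E : Pred Λ ℓ
      E i = x i ≡ r (F x) i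

      γ : κ
      γ = proj₁ (fresh infinite (F x ∷ []))

      γ∉ : γ ∉ F x ∷ []
      γ∉ = proj₂ (fresh infinite (F x ∷ []))

      y : Λ → κ
      y = piecewise E (const γ) (const (F x))

    -- At one point common to three large sets `r (F x)` and `r (F y)` meet, which already forces
    -- equal indices.
    large-agreement⇒same-color : ∀ x y → 𝒰 (λ i → x i ≡ y i) → F x ≡ F y
    large-agreement⇒same-color x y x≡y =
      let _ , xi≡yi , xi≡ri , yi≡ri = large-nonempty
            (large-∩ _ _ x≡y
              (large-∩ _ _ (agrees-with-representative x) (agrees-with-representative y)))
      in r-injective (trans (sym xi≡ri) (trans xi≡yi yi≡ri))

    same-color⇒large-agreement : ∀ x y → F x ≡ F y → 𝒰 (λ i → x i ≡ y i)
    same-color⇒large-agreement x y Fx≡Fy =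
      large-upward _ _
        (λ {i} (xi≡ri , yi≡ri) → trans xi≡ri (trans (cong (λ α → r α i) Fx≡Fy) (sym yi≡ri)))
        (large-∩ _ _ (agrees-with-representative x) (agrees-with-representative y))

    -- Otherwise the complements of all fibres are large, and by completeness some point `i` lies in
    -- all of them, even in that of the fibre over `x i`.
    large-fibre : ∀ (x : Λ → κ) → Σ[ α ∈ κ ] 𝒰 (λ i → x i ≡ α)
    large-fibre x = dne λ none →
      let i , misses = large-nonempty (isSuccComplete κ (↣-id κ) (λ α i → x i ≢ α)
            (λ α → [ (λ large → contradiction (α , large) none) , id ]
              (large⊎co-large (λ i → x i ≡ α))))
      in misses (x i) refl

    constant-color : Sym κ
    constant-color = mk⤖ {to = λ α → F (const α)}
      ( (λ {α} {β} eq → dne λ α≢β → proper (const α) (const β) (λ _ → α≢β) eq)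
      , strictlySurjective⇒surjective λ β →
          let α , rβ≡α = large-fibre (r β)
          in α , trans (sym (large-agreement⇒same-color _ (const α) rβ≡α)) (F-r β))

  -- From an ultrafilter and a permutation to a colouring.

  module _
    {κ Λ : Set ℓ} (F : (Λ → κ) → κ)
    (𝒰 : Pred (Pred Λ ℓ) ℓ) (ultrafilter : IsUltrafilter 𝒰) (π : Sym κ)
    (F-limit : ∀ x α → F x ≡ Bijection.to π α ⇔ 𝒰 (λ i → x i ≡ α))
    where

    open IsUltrafilter ultrafilter
    open Bijection π using (to; strictlySurjective)

    -- If the common colour is the image of `α`, both functions equal `α` on large sets, and these
    -- would be disjoint.
    limit-isProperColoring : IsProperColoring F
    limit-isProperColoring x y x⊥y Fx≡Fy =
      let α , πα≡Fx = strictlySurjective (F x)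
          x≡α = Equivalence.to (F-limit x α) (sym πα≡Fx)
          y≡α = Equivalence.to (F-limit y α) (trans (sym Fx≡Fy) (sym πα≡Fx))
      in empty (upward _ _
           (λ {i} (xi≡α , yi≡α) → contradiction (trans xi≡α (sym yi≡α)) (x⊥y i))
           (intersect _ _ x≡α y≡α))

    -- The representatives are the constant functions at the preimages under `π`.
    limit-isWeaklyUniform : IsWeaklyUniform F
    limit-isWeaklyUniform =
      (λ α _ → proj₁ (strictlySurjective α)) ,
      (λ α → trans
        (Equivalence.from (F-limit _ _) (upward _ _ (λ _ → refl) universe))
        (proj₂ (strictlySurjective α))) ,
      (λ α β α≢β _ eq → α≢β (trans (sym (proj₂ (strictlySurjective α)))
        (trans (cong to eq) (proj₂ (strictlySurjective β)))))

theorem3p10 : ∀ {ℓ} → ExcludedMiddle ℓ →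
    (κ Λ : Set ℓ) → Infinite κ →
    (F : (Λ → κ) → κ) →
    (IsProperColoring F × IsWeaklyUniform F)
    ⇔ (Σ[ 𝒰 ∈ Pred (Pred Λ ℓ) ℓ ] IsUltrafilter 𝒰 × IsSuccComplete κ 𝒰 ×
    (Σ[ π ∈ Sym κ ] (∀ (x : Λ → κ) (α : κ) →
    F x ≡ Bijection.to π α ⇔ 𝒰 (λ i → x i ≡ α))))
theorem3p10 em κ Λ infinite F = mk⇔
  (λ (proper , r , F-r , r-⊥) →
    let open WeaklyUniformColoring em infinite F proper r F-r r-⊥
    in 𝒰 , isUltrafilter , isSuccComplete , constant-color ,
       λ x α → mk⇔ (same-color⇒large-agreement x (const α))
                      (large-agreement⇒same-color x (const α)))
  (λ (𝒰 , ultrafilter , _ , π , F-limit) →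
    limit-isProperColoring em F 𝒰 ultrafilter π F-limit ,
    limit-isWeaklyUniform em F 𝒰 ultrafilter π F-limit)
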